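{- There exist hyperaperiodic elements in $\mathrm{Free}(\{0,1\}^{T_\Delta})/\sim$, i.e. elements $[\alpha]$ such that the closure in $\{0,1\}^{T_\Delta}/\sim$ of the connected component of $[\alpha]$ in $\mathcal{T}^{\{0,1\}}_\Delta$ is contained in $\mathrm{Free}(\{0,1\}^{T_\Delta})/\sim$.
   Context: $\Delta>2$. $T_\Delta$ is the infinite $\Delta$-regular tree with a fixed root $\mathfrak r$; $\operatorname{Aut}(T_\Delta)$ acts on $\{0,1\}^{T_\Delta}$ (product topology) by $(g\cdot x)(v)=x(g^{ -1}(v))$, and $\operatorname{Aut}^o(T_\Delta)$ is the stabilizer of $\mathfrak r$. $x\sim y$ iff $y=g\cdot x$ for some $g\in\operatorname{Aut}^o(T_\Delta)$; $\{0,1\}^{T_\Delta}/\sim$ carries the quotient topology. $\mathrm{Free}(\{0,1\}^{T_\Delta})$ is the set of $x$ with $g\cdot x\ne x$ for every non-identity $g\in\operatorname{Aut}(T_\Delta)$. The graph $\mathcal{G}_{\{0,1\},\Delta}$ on $\{0,1\}^{T_\Delta}/\sim$ joins $[x],[y]$ iff for every $z\in[x]$ there is $g\in\operatorname{Aut}(T_\Delta)$ moving $\mathfrak r$ to one of its neighbors with $g\cdot z\in[y]$; $\mathcal{T}^{\{0,1\}}_\Delta$ is its restriction to $\mathrm{Free}(\{0,1\}^{T_\Delta})/\sim$. -}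

module Defs where

open import Level using (Level; 0ℓ) renaming (suc to lsuc)
open import Data.Nat using (ℕ; _≤_)
open import Data.Fin using (Fin; _≟_)
open import Data.Bool using (Bool; true; false; T; not; _∧_)
open import Data.List using (List; []; _∷_; length)
open import Data.Product using (Σ; ∃; _×_; _,_; proj₁)
open import Data.Sum using (_⊎_)
open import Relation.Nullary using (¬_)
open import Relation.Nullary.Decidable using (⌊_⌋)
open import Relation.Binary.PropositionalEquality using (_≡_)

-- The Δ-regular tree T_Δ, modelled as the Cayley graph of the free product
-- of Δ copies of ℤ/2: vertices are reduced words over Fin Δ (no two
-- consecutive equal letters); the root is the empty word; two vertices are
-- adjacent iff one is obtained from the other by adding one letter.
-- (The head of the list is the most recently added letter.)
module _ (Δ : ℕ) where

  reducedᵇ : List (Fin Δ) → Bool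
  reducedᵇ [] = true
  reducedᵇ (a ∷ []) = true
  reducedᵇ (a ∷ b ∷ w) = not ⌊ a ≟ b ⌋ ∧ reducedᵇ (b ∷ w)

  Vertex : Set
  Vertex = Σ (List (Fin Δ)) (λ w → T (reducedᵇ w))

  root : Vertex
  root = [] , _

  depth : Vertex → ℕ
  depth v = length (proj₁ v)

  Adj : Vertex → Vertex → Set
  Adj u v = (Σ (Fin Δ) λ a → proj₁ v ≡ a ∷ proj₁ u)
          ⊎ (Σ (Fin Δ) λ a → proj₁ u ≡ a ∷ proj₁ v)

  record Aut : Set where
    field
      fun     : Vertex → Vertex
      inv     : Vertex → Vertex
      inv-fun : ∀ v → inv (fun v) ≡ v
      fun-inv : ∀ v → fun (inv v) ≡ v
      adj→    : ∀ u v → Adj u v → Adj (fun u) (fun v)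
      adj←    : ∀ u v → Adj (fun u) (fun v) → Adj u v
  open Aut public

  Coloring : Set
  Coloring = Vertex → Bool

  act : Aut → Coloring → Coloring
  act g x v = x (inv g v)

  _≈_ : Coloring → Coloring → Set
  x ≈ y = ∀ v → x v ≡ y v

  _∼_ : Coloring → Coloring → Set
  x ∼ y = Σ Aut λ g → (fun g root ≡ root) × (act g x ≈ y)

  IsIdentity : Aut → Set
  IsIdentity g = ∀ v → fun g v ≡ v

  Free : Coloring → Set
  Free x = (g : Aut) → ¬ IsIdentity g → ¬ (act g x ≈ x)

  -- Edge relation of 𝒢_{{0,1},Δ}, on representatives:
  -- [x] — [y] iff for every z ∈ [x] there is g ∈ Aut(T_Δ) moving the root
  -- to a neighbour of the root with g · z ∈ [y].
  Edge : Coloring → Coloring → Set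
  Edge x y = ∀ z → x ∼ z → Σ Aut λ g → Adj root (fun g root) × (act g z ∼ y)

  -- Representatives of the vertices of the connected component of [α] in
  -- 𝒯^{{0,1}}_Δ (the restriction of 𝒢 to Free/∼); edges are used in either
  -- direction (graph = symmetric edge relation).
  data Component (α : Coloring) : Coloring → Set where
    base : ∀ {x} → α ∼ x → Free x → Component α x
    step : ∀ {y z} → Component α y → Free z → (Edge y z ⊎ Edge z y)
         → Component α z

  -- Open sets of the quotient {0,1}^{T_Δ}/∼, via their (saturated, open)
  -- preimages in {0,1}^{T_Δ}, product topology (basic opens = cylinders,
  -- and every cylinder contains a cylinder fixing a ball around the root).
  Saturated : (Coloring → Set) → Set
  Saturated U = ∀ x y → x ∼ y → U x → U y

  OpenProd : (Coloring → Set) → Set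
  OpenProd U = ∀ x → U x → Σ ℕ λ n →
                 ∀ y → (∀ v → depth v ≤ n → x v ≡ y v) → U y

  InClosure : (Coloring → Set) → Coloring → Set₁
  InClosure S y = (U : Coloring → Set) → Saturated U → OpenProd U → U y →
                  Σ Coloring λ z → U z × S z

  Hyperaperiodic : Coloring → Set₁
  Hyperaperiodic α = Free α × (∀ y → InClosure (Component α) y → Free y)

-- Colour a vertex of even depth 2m by the m-th term of an aperiodic Toeplitz sequence, and a
-- vertex c ∷ b ∷ w of odd depth by whether c < b.  Then b ∷ w at even depth has exactly b
-- children coloured true, while the counts seen below a ∷ w at odd depth are all letters but a,
-- so siblings have non-isomorphic coloured subtrees of height two.
-- If an automorphism k preserves this colouring near x, some child of x is sent to a child of
-- k x, so a whole descending subtree is sent to a descending subtree.  It cannot be moved by an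
-- odd number of levels (even levels are monochromatic, odd ones are not) nor by a nonzero even
-- number (the sequence is aperiodic), so k preserves depth.  Hence k commutes with passing to
-- the parent, fixes a common ancestor of v and k v, and, telling siblings apart, fixes v.
-- The radius needed depends only on the distance from v to k v, so the argument applies to every
-- limit of the orbit of the colouring.
module Submission where

open import Defs
open import Data.Nat using (ℕ; zero; suc; _+_; _*_; _∸_; _≤_; _<_; z≤n; s≤s)
open import Data.Nat.Properties hiding (_≟_)
open import Data.Bool using (Bool; true; false; T; not)
open import Data.Bool.Properties using (T-irrelevant; T-∧; not-injective)
open import Data.Fin as Fin using (Fin; zero; suc; toℕ; fromℕ<; inject; _≟_)
open import Data.Fin.Properties as Fin
  using (toℕ-injective; toℕ<n; toℕ-inject; fromℕ<-injective; injective⇒≤)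
open import Data.List using (List; []; _∷_; length)
open import Data.List.Properties using (∷-injectiveˡ; ∷-injectiveʳ)
open import Data.Product using (Σ; ∃; _×_; _,_; proj₁; proj₂; ∃₂)
open import Data.Sum using (_⊎_; inj₁; inj₂; [_,_]′; swap)
open import Data.Unit using (tt)
open import Function using (_∘_; const)
open import Function.Bundles using (module Equivalence)
open import Relation.Nullary using (yes; no; contradiction)
open import Relation.Nullary.Decidable using (⌊_⌋)
open import Relation.Binary.PropositionalEquality

-- Parity and the period-doubling sequence.

half : ℕ → ℕ ⊎ ℕ
half zero    = inj₁ zero
half (suc n) = [ inj₂ , inj₁ ∘ suc ]′ (half n)

half-even : ∀ n → half (n * 2) ≡ inj₁ n
half-even zero    = refl
half-even (suc n) rewrite half-even n = refl

half-odd : ∀ n → half (suc (n * 2)) ≡ inj₂ n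
half-odd n rewrite half-even n = refl

odd≢even : ∀ m n → suc (m * 2) ≢ n * 2
odd≢even m n eq with () ← trans (sym (half-odd m)) (trans (cong half eq) (half-even n))

data Halved : ℕ → Set where
  even : ∀ m → Halved (m * 2)
  odd  : ∀ m → Halved (suc (m * 2))

halved : ∀ n → Halved n
halved zero = even zero
halved (suc n) with halved n
... | even m = odd m
... | odd m  = even (suc m)

half-≤ : ∀ m → m ≤ m * 2
half-≤ m = m≤m*n m 2

-- The first argument is fuel; any value exceeding the index gives the same result.
toeplitzFuel : ℕ → ℕ → Bool
toeplitzFuel zero    n = false
toeplitzFuel (suc k) n = [ const false , not ∘ toeplitzFuel k ]′ (half n)

toeplitzFuel-irrelevant : ∀ {k l n} → n < k → n < l → toeplitzFuel k n ≡ toeplitzFuel l n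
toeplitzFuel-irrelevant {suc k} {suc l} {n} (s≤s n≤k) (s≤s n≤l) with halved n
... | even m rewrite half-even m = refl
... | odd m rewrite half-odd m =
  cong not (toeplitzFuel-irrelevant (≤-trans (s≤s (half-≤ m)) n≤k) (≤-trans (s≤s (half-≤ m)) n≤l))

-- This is the period-doubling sequence: the n-th term is the parity of the exponent of 2 in n + 1,
-- `true` meaning odd.
toeplitz : ℕ → Bool
toeplitz n = toeplitzFuel (suc n) n

toeplitz-even : ∀ n → toeplitz (n * 2) ≡ false
toeplitz-even n rewrite half-even n = refl

toeplitz-odd : ∀ n → toeplitz (suc (n * 2)) ≡ not (toeplitz n)
toeplitz-odd n rewrite half-even n = cong not (toeplitzFuel-irrelevant (s≤s (half-≤ n)) ≤-refl)

next-multiple-of-4 : ∀ n → ∃₂ λ m q → m < 4 × m + n ≡ q * 2 * 2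
next-multiple-of-4 zero = 0 , 0 , s≤s z≤n , refl
next-multiple-of-4 (suc n) with next-multiple-of-4 n
... | zero  , q , _ , eq = 3 , suc q , ≤-refl , cong (4 +_) eq
... | suc m , q , m<4 , eq = m , q , ≤-trans (n≤1+n _) m<4 , trans (+-suc m n) eq

-- The recursion on p halves even periods; only the odd ones need a direct argument:
-- there the position m + t is even and m + t + p is 1 modulo 4.
toeplitz-aperiodic : ∀ k p → p < k → 0 < p → ∀ t →
  ∃ λ m → m < 4 * p × toeplitz (m + t) ≢ toeplitz (m + t + p)
toeplitz-aperiodic (suc k) p (s≤s p≤k) 0<p t with halved p
... | odd g with next-multiple-of-4 (t + g * 2)
...   | m , q , m<4 , eq = m , ≤-trans m<4 (*-monoʳ-≤ 4 0<p) , differ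
  where
  eq′ : m + t + g * 2 ≡ q * 2 * 2
  eq′ = trans (+-assoc m t _) eq
  at-p : toeplitz (m + t + suc (g * 2)) ≡ true
  at-p = trans (cong toeplitz (trans (+-suc (m + t) _) (cong suc eq′)))
        (trans (toeplitz-odd (q * 2)) (cong not (toeplitz-even q)))
  differ : toeplitz (m + t) ≢ toeplitz (m + t + suc (g * 2))
  differ same with m + t | halved (m + t) | eq′ | at-p
  ... | _ | even j | _ | at-p′ with () ← trans (sym (toeplitz-even j)) (trans same at-p′)
  ... | _ | odd j  | e | _ = odd≢even (j + g) (q * 2) (trans (cong suc (*-distribʳ-+ 2 j g)) e)
toeplitz-aperiodic (suc k) p (s≤s p≤k) 0<p t | even (suc g) = split (halved t)
  where
  differ : ∀ j → ∃ λ m → m < 4 * suc g × toeplitz (m + j) ≢ toeplitz (m + j + suc g)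
  differ = toeplitz-aperiodic k (suc g) (≤-trans (s≤s (s≤s (half-≤ g))) p≤k) (s≤s z≤n)

  -- At odd positions the sequence is its own negation at half the position, so a mismatch for
  -- `suc g` gives one for the doubled period. `split` chooses the offset that makes the position
  -- odd.
  lift : ∀ {m j t} → toeplitz (m + j) ≢ toeplitz (m + j + suc g) → t ≡ suc ((m + j) * 2) →
         toeplitz t ≢ toeplitz (t + suc g * 2)
  lift {m} {j} neq refl same = neq (not-injective (trans (sym (toeplitz-odd (m + j)))
    (trans same (trans (cong (toeplitz ∘ suc) (sym (*-distribʳ-+ 2 (m + j) (suc g))))
                       (toeplitz-odd (m + j + suc g))))))

  bound : ∀ {m} → m < 4 * suc g → suc (m * 2) < 4 * (suc g * 2)
  bound m< = ≤-trans (*-monoˡ-≤ 2 m<) (≤-reflexive (*-assoc 4 (suc g) 2))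

  split : ∀ {t} → Halved t → ∃ λ m → m < 4 * (suc g * 2) × toeplitz (m + t) ≢ toeplitz (m + t + suc g * 2)
  split (even j) with differ j
  ... | m , m< , neq = suc (m * 2) , bound m< , lift {m} {j} neq (cong suc (sym (*-distribʳ-+ 2 m j)))
  split (odd j) with differ j
  ... | m , m< , neq = m * 2 , ≤-trans (n≤1+n _) (bound m<) ,
    lift {m} {j} neq (trans (+-suc (m * 2) (j * 2)) (cong suc (sym (*-distribʳ-+ 2 m j))))

-- Parents, ancestors and walks in the tree.

module _ {Δ : ℕ} where

  private
    V = Vertex Δ
    variable
      u v w x y z : V
      i j m n t : ℕ

  record Child (p x : V) : Set where
    constructor child
    field
      letter : Fin Δ
      word   : proj₁ x ≡ letter ∷ proj₁ p

  Neighbour : V → V → Set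
  Neighbour u v = Child u v ⊎ Child v u

  neighbour-adj : Neighbour u v → Adj Δ u v
  neighbour-adj (inj₁ (child a eq)) = inj₁ (a , eq)
  neighbour-adj (inj₂ (child a eq)) = inj₂ (a , eq)

  adj-neighbour : Adj Δ u v → Neighbour u v
  adj-neighbour (inj₁ (a , eq)) = inj₁ (child a eq)
  adj-neighbour (inj₂ (a , eq)) = inj₂ (child a eq)

  vertex-≡ : {u v : V} → proj₁ u ≡ proj₁ v → u ≡ v
  vertex-≡ {w , _} refl = cong (w ,_) (T-irrelevant _ _)

  child-depth : Child u v → depth Δ v ≡ suc (depth Δ u)
  child-depth (child _ eq) = cong length eq

  parent-unique : Child u w → Child v w → u ≡ v
  parent-unique (child _ eq) (child _ eq′) = vertex-≡ (∷-injectiveʳ (trans (sym eq) eq′))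

  reduced-tail : ∀ a w → T (reducedᵇ Δ (a ∷ w)) → T (reducedᵇ Δ w)
  reduced-tail a [] _ = tt
  reduced-tail a (b ∷ w) r = proj₂ (Equivalence.to T-∧ r)

  reduced-head : ∀ {a b} w → T (reducedᵇ Δ (a ∷ b ∷ w)) → a ≢ b
  reduced-head {a} {b} _ r with a ≟ b
  ... | no a≢b = a≢b

  reduced-∷ : ∀ {a b} w → a ≢ b → T (reducedᵇ Δ (b ∷ w)) → T (reducedᵇ Δ (a ∷ b ∷ w))
  reduced-∷ {a} {b} _ a≢b r with a ≟ b
  ... | yes a≡b = contradiction a≡b a≢b
  ... | no _    = r

  up : V → V
  up ([] , r)    = [] , r
  up (a ∷ w , r) = w , reduced-tail a w r

  up-child : Child u v → up v ≡ u
  up-child {v = _ ∷ _ , _} (child _ refl) = vertex-≡ refl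

  up-cases : ∀ v → (depth Δ v ≡ 0 × up v ≡ v) ⊎ Child (up v) v
  up-cases ([] , r)    = inj₁ (refl , refl)
  up-cases (a ∷ w , r) = inj₂ (child a refl)

  ancestor : ℕ → V → V
  ancestor zero    v = v
  ancestor (suc n) v = ancestor n (up v)

  ancestor-up : ∀ n v → ancestor n (up v) ≡ up (ancestor n v)
  ancestor-up zero    v = refl
  ancestor-up (suc n) v = ancestor-up n (up v)

  ancestor-root : ∀ n {v : V} → depth Δ v ≡ 0 → ancestor n v ≡ v
  ancestor-root zero    _ = refl
  ancestor-root (suc n) {[] , _} refl = ancestor-root n refl

  depth-ancestor-≤ : ∀ n (v : V) → depth Δ (ancestor n v) ≤ depth Δ v
  depth-ancestor-≤ zero    v = ≤-refl
  depth-ancestor-≤ (suc n) ([] , r)    = depth-ancestor-≤ n ([] , r)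
  depth-ancestor-≤ (suc n) (a ∷ w , r) = ≤-trans (depth-ancestor-≤ n _) (n≤1+n _)

  -- The ancestors of `v` form one path to the root, with a single vertex at each depth. The indices
  -- can still differ once both have reached the root.
  ancestors-equal : ∀ i j {v : V} → depth Δ (ancestor i v) ≡ depth Δ (ancestor j v) →
                    ancestor i v ≡ ancestor j v
  ancestors-equal zero    zero    _ = refl
  ancestors-equal zero    (suc j) {[] , r} _ = sym (ancestor-root (suc j) refl)
  ancestors-equal zero    (suc j) {a ∷ w , r} eq =
    contradiction (depth-ancestor-≤ j _) (<⇒≱ (≤-reflexive eq))
  ancestors-equal (suc i) zero    {[] , r} _ = ancestor-root (suc i) refl
  ancestors-equal (suc i) zero    {a ∷ w , r} eq =
    contradiction (depth-ancestor-≤ i _) (<⇒≱ (≤-reflexive (sym eq)))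
  ancestors-equal (suc i) (suc j) eq = ancestors-equal i j eq

  -- Balls are described by walks, which automorphisms carry along directly; `here` exists at every
  -- `n`, so the index is only an upper bound on the length.
  data Within : ℕ → V → V → Set where
    here : Within n u u
    move : Within n u v → Neighbour v w → Within (suc n) u w

  within-mono : m ≤ n → Within m u v → Within n u v
  within-mono _ here = here
  within-mono (s≤s m≤n) (move p e) = move (within-mono m≤n p) e

  within-trans : Within m u v → Within n v w → Within (n + m) u w
  within-trans {m} {n = n} p here = within-mono (m≤n+m m n) p
  within-trans p (move q e) = move (within-trans p q) e

  within-sym : Within n u v → Within n v u
  within-sym here = here
  within-sym {n = suc n} (move p e) =
    within-mono (≤-reflexive (+-comm n 1)) (within-trans (move here (swap e)) (within-sym p))

  within-depth : Within n u v → depth Δ v ≤ n + depth Δ u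
  within-depth {n} here = m≤n+m _ n
  within-depth (move p (inj₁ c)) = ≤-trans (≤-reflexive (child-depth c)) (s≤s (within-depth p))
  within-depth (move p (inj₂ c)) = ≤-trans (n≤1+n _) (≤-trans (≤-reflexive (sym (child-depth c)))
                                     (≤-trans (within-depth p) (n≤1+n _)))

  within-up : ∀ v → Within 1 v (up v)
  within-up ([] , r)    = here
  within-up (a ∷ w , r) = move here (inj₂ (child a refl))

  within-ancestor : ∀ n v → Within n v (ancestor n v)
  within-ancestor zero    v = here
  within-ancestor (suc n) v =
    within-mono (≤-reflexive (+-comm n 1)) (within-trans (within-up v) (within-ancestor n (up v)))

  within-root : ∀ w r → Within (length w) (root Δ) (w , r)
  within-root []      r = here
  within-root (a ∷ w) r = move (within-root w (reduced-tail a w r)) (inj₁ (child a refl))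

  -- Induction along the walk. A step to a child lengthens the ascent from the endpoint. A step to a
  -- parent shortens it or, if the endpoint is itself the meeting point, raises that point by one,
  -- at the cost of one in `i`.
  common-ancestor : Within n u v → ∃₂ λ i j → i ≤ n × ancestor i u ≡ ancestor j v
  common-ancestor here = 0 , 0 , z≤n , refl
  common-ancestor (move p e) with common-ancestor p
  common-ancestor (move p (inj₁ c)) | i , j , i≤n , eq =
    i , suc j , m≤n⇒m≤1+n i≤n , trans eq (cong (ancestor j) (sym (up-child c)))
  common-ancestor (move p (inj₂ c)) | i , suc j , i≤n , eq =
    i , j , m≤n⇒m≤1+n i≤n , trans eq (cong (ancestor j) (up-child c))
  common-ancestor (move p (inj₂ c)) | i , zero , i≤n , eq =
    suc i , 0 , s≤s i≤n , trans (ancestor-up i _) (trans (cong up eq) (up-child c))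

  data Below (x : V) : ℕ → V → Set where
    here : Below x 0 x
    down : Below x t y → Child y z → Below x (suc t) z

  below-within : Below x t y → Within t x y
  below-within here = here
  below-within (down b c) = move (below-within b) (inj₁ c)

  below-depth : Below x t y → depth Δ y ≡ t + depth Δ x
  below-depth here = refl
  below-depth (down b c) = trans (child-depth c) (cong suc (below-depth b))

  -- Automorphisms and the edges they send downwards.

  inverse : Aut Δ → Aut Δ
  inverse g = record
    { fun     = inv g
    ; inv     = fun g
    ; inv-fun = fun-inv g
    ; fun-inv = inv-fun g
    ; adj→    = λ u v e → adj← g _ _ (subst₂ (Adj Δ) (sym (fun-inv g u)) (sym (fun-inv g v)) e)
    ; adj←    = λ u v e → subst₂ (Adj Δ) (fun-inv g u) (fun-inv g v) (adj→ g _ _ e)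
    }

  identity : Aut Δ
  identity = record
    { fun = λ v → v ; inv = λ v → v ; inv-fun = λ _ → refl ; fun-inv = λ _ → refl
    ; adj→ = λ _ _ e → e ; adj← = λ _ _ e → e }

  infixr 9 _∘ₐ_
  _∘ₐ_ : Aut Δ → Aut Δ → Aut Δ
  g ∘ₐ h = record
    { fun     = fun g ∘ fun h
    ; inv     = inv h ∘ inv g
    ; inv-fun = λ v → trans (cong (inv h) (inv-fun g _)) (inv-fun h v)
    ; fun-inv = λ v → trans (cong (fun g) (fun-inv h _)) (fun-inv g v)
    ; adj→    = λ u v e → adj→ g _ _ (adj→ h u v e)
    ; adj←    = λ u v e → adj← h u v (adj← g _ _ e)
    }

  fun-injective : (g : Aut Δ) → fun g u ≡ fun g v → u ≡ v
  fun-injective g eq = trans (sym (inv-fun g _)) (trans (cong (inv g) eq) (inv-fun g _))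

  neighbour-map : (g : Aut Δ) → Neighbour u v → Neighbour (fun g u) (fun g v)
  neighbour-map g e = adj-neighbour (adj→ g _ _ (neighbour-adj e))

  within-map : (g : Aut Δ) → Within n u v → Within n (fun g u) (fun g v)
  within-map g here = here
  within-map g (move p e) = move (within-map g p) (neighbour-map g e)

  -- A single such edge forces every edge below `x` to be sent downwards as well.
  Descends : Aut Δ → V → V → Set
  Descends k p x = Child p x × Child (fun k p) (fun k x)

  child-map : (k : Aut Δ) → depth Δ (fun k u) ≡ depth Δ u → depth Δ (fun k v) ≡ depth Δ v →
              Child u v → Child (fun k u) (fun k v)
  child-map k du dv c with neighbour-map k (inj₁ c)
  ... | inj₁ c′ = c′
  ... | inj₂ c′ = contradiction
    (trans (sym du) (trans (child-depth c′) (cong suc (trans dv (child-depth c))))) (<⇒≢ (m<n⇒m<1+n ≤-refl))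

  fun-up : (k : Aut Δ) → depth Δ (fun k (up v)) ≡ depth Δ (up v) → depth Δ (fun k v) ≡ depth Δ v →
           fun k (up v) ≡ up (fun k v)
  fun-up {v} k du dv with up-cases v
  ... | inj₂ c = sym (up-child (child-map k du dv c))
  ... | inj₁ (d≡0 , eq) = trans (cong (fun k) eq) (sym (ancestor-root 1 (trans dv d≡0)))

  descends-inverse : (k : Aut Δ) → Descends k x y → Descends (inverse k) (fun k x) (fun k y)
  descends-inverse k (c , c′) = c′ , subst₂ Child (sym (inv-fun k _)) (sym (inv-fun k _)) c

  -- Were the edge to `z` turned upwards, `fun k z` would be the parent of `fun k y`, that is
  -- `fun k x`; then `z` would equal `x`, two levels higher.
  descends-child : (k : Aut Δ) → Descends k x y → Child y z → Descends k y z
  descends-child k (c , c′) d with neighbour-map k (inj₁ d)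
  ... | inj₁ d′ = d , d′
  ... | inj₂ d′ with fun-injective k (parent-unique c′ d′)
  ...   | refl = contradiction (trans (child-depth d) (cong suc (child-depth c))) (<⇒≢ (m<n⇒m<1+n ≤-refl))

  below-map : (k : Aut Δ) → Descends k x y → Below y t z → Below (fun k y) t (fun k z)
  below-map {x} {y} k g b = proj₁ (go b)
    where
    -- The induction also carries the descending edge into the current vertex, from which the next
    -- one is obtained.
    go : ∀ {t z} → Below y t z → Below (fun k y) t (fun k z) × Σ V λ p → Descends k p z
    go here = here , x , g
    go (down b c) with go b
    ... | b′ , p , g′ = down b′ (proj₂ (descends-child k g′ c)) , _ , descends-child k g′ c

  -- The colouring and the letters it reveals.

  colour : List (Fin Δ) → Bool
  colour w = [ toeplitz , (λ _ → descent w) ]′ (half (length w))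
    where
    descent : List (Fin Δ) → Bool
    descent (c ∷ b ∷ _) = ⌊ c Fin.<? b ⌋
    -- Among words of odd length only those of length one end up here: the children of the root,
    -- which have no second letter to compare.
    descent _           = false

  α : Coloring Δ
  α v = colour (proj₁ v)

  α-even : ∀ m (v : V) → depth Δ v ≡ m * 2 → α v ≡ toeplitz m
  α-even m (w , _) eq with length w
  α-even m _ refl | _ rewrite half-even m = refl

  α-odd : ∀ m (v : V) {c b w} → proj₁ v ≡ c ∷ b ∷ w → depth Δ v ≡ suc (m * 2) → α v ≡ ⌊ c Fin.<? b ⌋
  α-odd m (_ ∷ _ ∷ w , _) refl eq rewrite trans (cong half eq) (half-odd m) = refl

  -- Invariance is local because a limit of the orbit matches translates of `α` only on finite
  -- balls.
  InvariantNear : ℕ → Aut Δ → V → Set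
  InvariantNear r k x = ∀ y → Within r x y → α (fun k y) ≡ α y

  invariant-near : ∀ {r} (k : Aut Δ) → Within m x y → n + m ≤ r → InvariantNear r k x → InvariantNear n k y
  invariant-near k p le I y q = I y (within-mono le (within-trans p q))

  invariant-mono : (k : Aut Δ) → m ≤ n → InvariantNear n k x → InvariantNear m k x
  invariant-mono k le I y p = I y (within-mono le p)

  invariant-inverse : ∀ {r} (k : Aut Δ) → InvariantNear r k x → InvariantNear r (inverse k) (fun k x)
  invariant-inverse {x} {r} k I y p = sym (trans (cong α (sym (fun-inv k y)))
    (I (inv k y) (subst (λ z → Within r z (inv k y)) (inv-fun k x) (within-map (inverse k) p))))

  -- At even depth the colours of the children of b ∷ w reveal b as the number of children coloured true.
  children-count-≤ : (k : Aut Δ) → ∀ {p b b′ w w′} → Descends k p x → InvariantNear 1 k x →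
    ∀ m m′ → depth Δ x ≡ m * 2 → depth Δ (fun k x) ≡ m′ * 2 →
    proj₁ x ≡ b ∷ w → proj₁ (fun k x) ≡ b′ ∷ w′ → toℕ b ≤ toℕ b′
  children-count-≤ {x@(_ , r)} k {b = b} {b′} {w} {w′} d I m m′ dx dkx refl wkx = injective⇒≤ {f = f} f-inj
    where
    c : Fin (toℕ b) → Fin Δ
    c = inject

    c<b : ∀ i → c i Fin.< b
    c<b i = ≤-trans (≤-reflexive (cong suc (toℕ-inject i))) (toℕ<n i)

    yᵢ : Fin (toℕ b) → V
    yᵢ i = c i ∷ b ∷ w , reduced-∷ w (Fin.<⇒≢ (c<b i)) r

    x→y : ∀ i → Child x (yᵢ i)
    x→y i = child (c i) refl

    kx→ky : ∀ i → Child (fun k x) (fun k (yᵢ i))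
    kx→ky i = proj₂ (descends-child k d (x→y i))

    c′ : Fin (toℕ b) → Fin Δ
    c′ i = Child.letter (kx→ky i)

    true-colour : ∀ i → ⌊ c′ i Fin.<? b′ ⌋ ≡ true
    true-colour i = trans (sym (α-odd m′ (fun k (yᵢ i)) (trans (Child.word (kx→ky i)) (cong (c′ i ∷_) wkx))
                                         (trans (child-depth (kx→ky i)) (cong suc dkx))))
                   (trans (I (yᵢ i) (move here (inj₁ (x→y i))))
                   (trans (α-odd m (yᵢ i) refl (cong suc dx)) is-true))
      where
      is-true : ⌊ c i Fin.<? b ⌋ ≡ true
      is-true with c i Fin.<? b
      ... | yes _ = refl
      ... | no ≮  = contradiction (c<b i) ≮

    c′<b′ : ∀ i → c′ i Fin.< b′
    c′<b′ i with c′ i Fin.<? b′ | true-colour i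
    ... | yes < | _ = <

    f : Fin (toℕ b) → Fin (toℕ b′)
    f i = fromℕ< (c′<b′ i)

    f-inj : ∀ {i j} → f i ≡ f j → i ≡ j
    f-inj {i} {j} eq = toℕ-injective (trans (sym (toℕ-inject i)) (trans (cong toℕ c-eq) (toℕ-inject j)))
      where
      c′-eq : c′ i ≡ c′ j
      c′-eq = toℕ-injective (fromℕ<-injective _ _ (c′<b′ i) (c′<b′ j) eq)
      c-eq : c i ≡ c j
      c-eq = ∷-injectiveˡ (cong proj₁ (fun-injective {yᵢ i} {yᵢ j} k (vertex-≡
        (trans (Child.word (kx→ky i)) (trans (cong (_∷ _) c′-eq) (sym (Child.word (kx→ky j))))))))

  even-letter-preserved : (k : Aut Δ) → ∀ {p b b′ w w′} → Descends k p x → InvariantNear 1 k x →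
    ∀ m m′ → depth Δ x ≡ m * 2 → depth Δ (fun k x) ≡ m′ * 2 →
    proj₁ x ≡ b ∷ w → proj₁ (fun k x) ≡ b′ ∷ w′ → b ≡ b′
  even-letter-preserved k d I m m′ dx dkx wx wkx = toℕ-injective (≤-antisym
    (children-count-≤ k d I m m′ dx dkx wx wkx)
    (children-count-≤ (inverse k) (descends-inverse k d) (invariant-inverse k I) m′ m dkx
      (trans (cong (depth Δ) (inv-fun k _)) dx) wkx (trans (cong proj₁ (inv-fun k _)) wx)))

  -- At odd depth the letters of the children of b ∷ w, recovered by even-letter-preserved,
  -- are all the letters except b.
  siblings-distinguished : (k : Aut Δ) → ∀ {p} → Child p x → Child p (fun k x) → fun k p ≡ p →
    InvariantNear 2 k x → fun k x ≡ x
  siblings-distinguished {x} k {p} c c′ kp≡p I = go (halved (depth Δ x)) refl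
    where
    b  = Child.letter c
    b′ = Child.letter c′

    d : Descends k p x
    d = c , subst (λ q → Child q (fun k x)) (sym kp≡p) c′

    depth-kx : depth Δ (fun k x) ≡ depth Δ x
    depth-kx = trans (child-depth c′) (sym (child-depth c))

    same-letter : b ≡ b′ → fun k x ≡ x
    same-letter eq = vertex-≡ (trans (Child.word c′) (trans (cong (_∷ proj₁ p) (sym eq)) (sym (Child.word c))))

    go : ∀ {t} → Halved t → depth Δ x ≡ t → fun k x ≡ x
    go (even m) dx = same-letter (even-letter-preserved k d (invariant-mono k (s≤s z≤n) I) m m
      dx (trans depth-kx dx) (Child.word c) (Child.word c′))
    go (odd m) dx with b ≟ b′
    ... | yes eq = same-letter eq
    -- As `b′` differs from `b`, the vertex `x` has a child with letter `b′`. Its image keeps that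
    -- letter but sits below `fun k x`, which already starts with `b′`, so the image word would not
    -- be reduced.
    ... | no b≢b′ = contradiction b′≡a (reduced-head (proj₁ p) r′ ∘ sym)
      where
      r : T (reducedᵇ Δ (b′ ∷ proj₁ x))
      r = subst (λ w → T (reducedᵇ Δ (b′ ∷ w))) (sym (Child.word c))
            (reduced-∷ (proj₁ p) (b≢b′ ∘ sym) (subst (T ∘ reducedᵇ Δ) (Child.word c) (proj₂ x)))
      y₀ : V
      y₀ = b′ ∷ proj₁ x , r
      x→y : Child x y₀
      x→y = child b′ refl
      d′ : Descends k x y₀
      d′ = descends-child k d x→y
      a = Child.letter (proj₂ d′)
      b′≡a : b′ ≡ a
      b′≡a = even-letter-preserved k d′ (invariant-near k (move here (inj₁ x→y)) ≤-refl I) (suc m) (suc m)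
        (cong suc dx) (trans (child-depth (proj₂ d′)) (cong suc (trans depth-kx dx)))
        refl (Child.word (proj₂ d′))
      r′ : T (reducedᵇ Δ (a ∷ b′ ∷ proj₁ p))
      r′ = subst (T ∘ reducedᵇ Δ) (trans (Child.word (proj₂ d′)) (cong (a ∷_) (Child.word c′))) (proj₂ (fun k y₀))

-- Preservation of depth and vanishing of displacement for degree at least three.

module _ {l : ℕ} where

  private
    Δ : ℕ
    Δ = suc (suc (suc l))
    V = Vertex Δ
    variable
      x y : V

  two-children : (v : V) → ∃₂ λ y z → Child v y × Child v z × y ≢ z
  two-children ([] , r) =
    (zero ∷ [] , tt) , (suc zero ∷ [] , tt) , child _ refl , child _ refl , λ ()
  two-children (zero ∷ w , r) =
    (suc zero ∷ zero ∷ w , r) , (suc (suc zero) ∷ zero ∷ w , r) , child _ refl , child _ refl , λ ()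
  two-children (suc zero ∷ w , r) =
    (zero ∷ suc zero ∷ w , r) , (suc (suc zero) ∷ suc zero ∷ w , r) , child _ refl , child _ refl , λ ()
  two-children (suc (suc a) ∷ w , r) =
    (zero ∷ suc (suc a) ∷ w , r) , (suc zero ∷ suc (suc a) ∷ w , r) , child _ refl , child _ refl , λ ()

  -- At most one child of `x` can be sent to the parent of `fun k x`, so one of any two children
  -- goes downwards.
  descending-child : (k : Aut Δ) (x : V) → ∃ λ c → Descends k x c
  descending-child k x with two-children x
  ... | y , z , x→y , x→z , y≢z with neighbour-map k (inj₁ x→y) | neighbour-map k (inj₁ x→z)
  ...   | inj₁ c | _      = y , x→y , c
  ...   | inj₂ _ | inj₁ c = z , x→z , c
  ...   | inj₂ c | inj₂ c′ = contradiction (fun-injective k (parent-unique c c′)) y≢z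

  colours-differ-below : ∀ m (z : V) → depth Δ z ≡ suc (m * 2) →
    ∃₂ λ y y′ → Below z 2 y × Below z 2 y′ × α y ≢ α y′
  colours-differ-below m z@(a ∷ w , r) dz = pick a refl
    where
    pair : ∀ c b c′ b′ → T (reducedᵇ Δ (c ∷ b ∷ a ∷ w)) → T (reducedᵇ Δ (c′ ∷ b′ ∷ a ∷ w)) →
           ⌊ c Fin.<? b ⌋ ≢ ⌊ c′ Fin.<? b′ ⌋ → ∃₂ λ y y′ → Below z 2 y × Below z 2 y′ × α y ≢ α y′
    pair c b c′ b′ r₁ r₂ neq = (c ∷ b ∷ a ∷ w , r₁) , (c′ ∷ b′ ∷ a ∷ w , r₂) ,
      grandchild c b r₁ , grandchild c′ b′ r₂ ,
      λ eq → neq (trans (sym (α-odd (suc m) (c ∷ b ∷ a ∷ w , r₁) refl (cong (2 +_) dz)))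
                 (trans eq (α-odd (suc m) (c′ ∷ b′ ∷ a ∷ w , r₂) refl (cong (2 +_) dz))))
      where
      grandchild : ∀ c b r → Below z 2 (c ∷ b ∷ a ∷ w , r)
      grandchild c b r = down {y = b ∷ a ∷ w , reduced-tail c (b ∷ a ∷ w) r}
                             (down here (child b refl)) (child c refl)

    0F 1F 2F : Fin Δ
    0F = zero
    1F = suc zero
    2F = suc (suc zero)

    -- The middle letters avoid `a`; the first pair has `c < b`, the second the reverse.
    pick : ∀ e → a ≡ e → ∃₂ λ y y′ → Below z 2 y × Below z 2 y′ × α y ≢ α y′
    pick zero refl = pair 0F 1F 2F 1F r r λ ()
    pick (suc zero) refl = pair 1F 2F 1F 0F r r λ ()
    pick (suc (suc _)) refl = pair 0F 1F 2F 1F r r λ ()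

  some-below : ∀ t (x : V) → ∃ λ y → Below x t y
  some-below zero x = x , here
  some-below (suc t) x with some-below t x
  ... | y , b with two-children y
  ...   | z , _ , c , _ = z , down b c

  -- A place near `x` where levels can be compared: at even depth, with its subtree sent downwards,
  -- and with the same depth shift as at `x`.
  record EvenDescent (k : Aut Δ) (x : V) : Set where
    field
      {parent vertex} : V
      half-depth      : ℕ
      descends        : Descends k parent vertex
      near            : Within 2 x vertex
      depth-even      : depth Δ vertex ≡ half-depth * 2
      depth-image     : ∀ {e} → depth Δ (fun k x) ≡ e + depth Δ x → depth Δ (fun k vertex) ≡ e + depth Δ vertex

  descent-depth : (k : Aut Δ) → Descends k x y → ∀ {e} → depth Δ (fun k x) ≡ e + depth Δ x →
                  depth Δ (fun k y) ≡ e + depth Δ y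
  descent-depth k (c , c′) {e} eq = trans (child-depth c′) (trans (cong suc eq)
    (trans (sym (+-suc e _)) (cong (e +_) (sym (child-depth c)))))

  even-descent : (k : Aut Δ) (x : V) → EvenDescent k x
  even-descent k x with descending-child k x
  ... | c , d = go (halved (depth Δ c)) refl
    where
    go : ∀ {t} → Halved t → depth Δ c ≡ t → EvenDescent k x
    go (even m) eq = record
      { half-depth = m ; descends = d ; near = move here (inj₁ (proj₁ d)) ; depth-even = eq
      ; depth-image = descent-depth k d }
    go (odd m) eq with two-children c
    ... | y , _ , c→y , _ = record
      { half-depth = suc m ; descends = d′ ; near = move (move here (inj₁ (proj₁ d))) (inj₁ c→y)
      ; depth-even = trans (child-depth c→y) (cong suc eq)
      ; depth-image = descent-depth k d′ ∘ descent-depth k d }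
      where d′ = descends-child k d c→y

  -- The radius pays for two steps to the vertex of `even-descent` and then a descent: two levels if
  -- `e` is odd, and fewer than `4 * e` if `e` is twice a period p, since a mismatch occurs within
  -- 4p terms.
  no-depth-shift : ∀ e (k : Aut Δ) (x : V) → depth Δ (fun k x) ≡ e + depth Δ x →
    InvariantNear (4 + 4 * e) k x → e ≡ 0
  no-depth-shift e k x eq I = go (halved e) refl
    where
    open EvenDescent (even-descent k x) renaming (half-depth to r; vertex to q; depth-even to dq)

    go : ∀ {s} → Halved s → e ≡ s → e ≡ 0
    go (even zero) e≡ = e≡
    go (even (suc f)) refl with toeplitz-aperiodic (suc (suc f)) (suc f) ≤-refl (s≤s z≤n) r
    ... | m , m<4p , differ with some-below (m * 2) q
    ...   | y , b = contradiction toeplitz-eq differ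
      where
      depth-y : depth Δ y ≡ (m + r) * 2
      depth-y = trans (below-depth b) (trans (cong (m * 2 +_) dq) (sym (*-distribʳ-+ 2 m r)))
      depth-ky : depth Δ (fun k y) ≡ (m + r + suc f) * 2
      depth-ky = begin
        depth Δ (fun k y)                   ≡⟨ below-depth (below-map k descends b) ⟩
        m * 2 + depth Δ (fun k q)           ≡⟨ cong (m * 2 +_) (depth-image eq) ⟩
        m * 2 + (suc f * 2 + depth Δ q)     ≡⟨ cong (m * 2 +_) (+-comm (suc f * 2) _) ⟩
        m * 2 + (depth Δ q + suc f * 2)     ≡⟨ sym (+-assoc (m * 2) _ _) ⟩
        m * 2 + depth Δ q + suc f * 2       ≡⟨ cong (_+ suc f * 2) (trans (sym (below-depth b)) depth-y) ⟩
        (m + r) * 2 + suc f * 2             ≡⟨ sym (*-distribʳ-+ 2 (m + r) (suc f)) ⟩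
        (m + r + suc f) * 2                 ∎
        where open ≡-Reasoning
      close : m * 2 + 2 ≤ 4 + 4 * (suc f * 2)
      close = ≤-trans (+-monoˡ-≤ 2 (≤-trans (*-monoˡ-≤ 2 (<⇒≤ m<4p)) (≤-reflexive (*-assoc 4 (suc f) 2))))
              (≤-trans (≤-reflexive (+-comm (4 * (suc f * 2)) 2))
                       (+-monoˡ-≤ (4 * (suc f * 2)) {2} {4} (s≤s (s≤s z≤n))))
      toeplitz-eq : toeplitz (m + r) ≡ toeplitz (m + r + suc f)
      toeplitz-eq = trans (sym (α-even (m + r) y depth-y))
        (trans (sym (I y (within-mono close (within-trans near (below-within b)))))
               (α-even (m + r + suc f) (fun k y) depth-ky))
    -- `fun k q` has odd depth, so two vertices two levels below it differ in colour; both pull back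
    -- to one even level, where all colours agree.
    go (odd f) refl with colours-differ-below (f + r) (fun k q)
      (trans (depth-image eq) (cong suc (trans (cong (f * 2 +_) dq) (sym (*-distribʳ-+ 2 f r)))))
    ... | y , y′ , b , b′ , differ = contradiction (trans (pulled b) (sym (pulled b′))) differ
      where
      pulled : ∀ {y} → Below (fun k q) 2 y → α y ≡ toeplitz (suc r)
      pulled {y} b = trans (cong α (sym (fun-inv k y)))
        (trans (I (inv k y) (within-mono (m≤m+n 4 _) (within-trans near (below-within b⁻¹))))
               (α-even (suc r) (inv k y) (trans (below-depth b⁻¹) (cong (2 +_) dq))))
        where
        b⁻¹ : Below q 2 (inv k y)
        b⁻¹ = subst (λ z → Below z 2 (inv k y)) (inv-fun k q)
                (below-map (inverse k) (descends-inverse k descends) b)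

  -- An image shallower than `x` is handled by the inverse at `fun k x`. The bound `d` fixes a
  -- radius before the actual shift is known.
  depth-preserved : ∀ d (k : Aut Δ) (x : V) →
    depth Δ (fun k x) ≤ d + depth Δ x → depth Δ x ≤ d + depth Δ (fun k x) →
    InvariantNear (4 + 4 * d) k x → depth Δ (fun k x) ≡ depth Δ x
  depth-preserved d k x le ge I with ≤-total (depth Δ x) (depth Δ (fun k x))
  ... | inj₁ p = trans eq (cong (_+ depth Δ x)
                   (no-depth-shift e k x eq (invariant-mono k (+-monoʳ-≤ 4 (*-monoʳ-≤ 4 e≤d)) I)))
    where
    e = depth Δ (fun k x) ∸ depth Δ x
    eq : depth Δ (fun k x) ≡ e + depth Δ x
    eq = sym (m∸n+n≡m p)
    e≤d : e ≤ d
    e≤d = m≤n+o⇒m∸n≤o _ _ (≤-trans le (≤-reflexive (+-comm d _)))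
  ... | inj₂ p = sym (trans eq (cong (_+ depth Δ (fun k x))
                   (no-depth-shift e (inverse k) (fun k x) (trans (cong (depth Δ) (inv-fun k x)) eq)
                     (invariant-mono (inverse k) (+-monoʳ-≤ 4 (*-monoʳ-≤ 4 e≤d)) (invariant-inverse k I)))))
    where
    e = depth Δ x ∸ depth Δ (fun k x)
    eq : depth Δ x ≡ e + depth Δ (fun k x)
    eq = sym (m∸n+n≡m p)
    e≤d : e ≤ d
    e≤d = m≤n+o⇒m∸n≤o _ _ (≤-trans ge (≤-reflexive (+-comm d _)))

  -- An ancestor used here moves by at most `d + d + d`: down to `v`, across to `fun k v`, and up
  -- again. The last `d` in the radius recentres the ball from `v` to that ancestor.
  displacement-zero : ∀ d (k : Aut Δ) (v : V) → Within d v (fun k v) →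
    InvariantNear (4 + 4 * (d + d + d) + d) k v → fun k v ≡ v
  displacement-zero d k v p I with common-ancestor p
  ... | i , j , i≤d , meet = descend i i≤d (trans (ancestor-map i i≤d) (trans same-ancestor (sym meet)))
    where
    to-ancestor : ∀ i → i ≤ d → Within d v (ancestor i v)
    to-ancestor i i≤d = within-mono i≤d (within-ancestor i v)

    invariant : ∀ i → i ≤ d → InvariantNear (4 + 4 * (d + d + d)) k (ancestor i v)
    invariant i i≤d = invariant-near k (to-ancestor i i≤d) ≤-refl I

    depth-fixed : ∀ i → i ≤ d → depth Δ (fun k (ancestor i v)) ≡ depth Δ (ancestor i v)
    depth-fixed i i≤d = depth-preserved (d + d + d) k (ancestor i v)
      (within-depth path) (within-depth (within-sym path)) (invariant i i≤d)
      where
      path : Within (d + d + d) (ancestor i v) (fun k (ancestor i v))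
      path = subst (λ n → Within n (ancestor i v) (fun k (ancestor i v))) (sym (+-assoc d d d))
        (within-trans (within-trans (within-sym (to-ancestor i i≤d)) p) (within-map k (to-ancestor i i≤d)))

    ancestor-map : ∀ i → i ≤ d → fun k (ancestor i v) ≡ ancestor i (fun k v)
    ancestor-map zero    _ = refl
    ancestor-map (suc i) i<d = begin
      fun k (ancestor i (up v))   ≡⟨ cong (fun k) (ancestor-up i v) ⟩
      fun k (up (ancestor i v))   ≡⟨ fun-up k depth-up (depth-fixed i (<⇒≤ i<d)) ⟩
      up (fun k (ancestor i v))   ≡⟨ cong up (ancestor-map i (<⇒≤ i<d)) ⟩
      up (ancestor i (fun k v))   ≡⟨ sym (ancestor-up i (fun k v)) ⟩
      ancestor i (up (fun k v))   ∎
      where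
      open ≡-Reasoning
      depth-up : depth Δ (fun k (up (ancestor i v))) ≡ depth Δ (up (ancestor i v))
      depth-up = subst (λ x → depth Δ (fun k x) ≡ depth Δ x) (ancestor-up i v) (depth-fixed (suc i) i<d)

    same-ancestor : ancestor i (fun k v) ≡ ancestor j (fun k v)
    same-ancestor = ancestors-equal i j (trans (cong (depth Δ) (sym (ancestor-map i i≤d)))
      (trans (depth-fixed i i≤d) (cong (depth Δ) meet)))

    descend : ∀ i → i ≤ d → fun k (ancestor i v) ≡ ancestor i v → fun k v ≡ v
    descend zero    _   eq = eq
    descend (suc i) i<d eq = descend i (<⇒≤ i<d) x-fixed
      where
      x₀ = ancestor i v
      up-fixed : fun k (up x₀) ≡ up x₀
      up-fixed = subst (λ y → fun k y ≡ y) (ancestor-up i v) eq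
      x-fixed : fun k x₀ ≡ x₀
      x-fixed with up-cases x₀
      ... | inj₁ (_ , up≡) = subst (λ y → fun k y ≡ y) up≡ up-fixed
      ... | inj₂ c = siblings-distinguished k c
        (subst (λ q → Child q (fun k x₀)) up-fixed
          (child-map k (cong (depth Δ) up-fixed) (depth-fixed i (<⇒≤ i<d)) c))
        up-fixed (invariant-mono k (s≤s (s≤s z≤n)) (invariant i (<⇒≤ i<d)))

  -- Freeness of limits of the orbit.

  -- The closure of the full `Aut` orbit of `α` in the product topology; `α ∘ fun h` is the
  -- translate of `α` by the inverse of `h`.
  OrbitLimit : Coloring Δ → Set
  OrbitLimit x = ∀ n → Σ (Aut Δ) λ h → ∀ v → Within n (root Δ) v → x v ≡ α (fun h v)

  -- Conjugating g by h turns the invariance of x under g into invariance of α near h v.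
  orbit-limit-free : ∀ {x} → OrbitLimit x → Free Δ x
  orbit-limit-free {x} limit g g≢id gx≈x = g≢id fixed
    where
    fixed : ∀ v → fun g v ≡ v
    fixed v = fun-injective h (trans (cong (fun h ∘ fun g) (sym (inv-fun h v)))
                (displacement-zero d k (fun h v) moved invariant))
      where
      a = depth Δ v
      b = depth Δ (fun g v)
      -- The path through the root bounds the displacement of `v`, and the ball of radius `N + d`
      -- about the root contains those of radius `N` about `v` and `fun g v`.
      d = b + a
      N = 4 + 4 * (d + d + d) + d
      toᵛ : Within a (root Δ) v
      toᵛ = within-root (proj₁ v) (proj₂ v)
      toᵍᵛ : Within b (root Δ) (fun g v)
      toᵍᵛ = within-root (proj₁ (fun g v)) (proj₂ (fun g v))
      h : Aut Δ
      h = proj₁ (limit (N + d))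
      agree : ∀ v → Within (N + d) (root Δ) v → x v ≡ α (fun h v)
      agree = proj₂ (limit (N + d))
      k : Aut Δ
      k = h ∘ₐ g ∘ₐ inverse h
      moved : Within d (fun h v) (fun k (fun h v))
      moved = subst (λ z → Within d (fun h v) (fun h (fun g z))) (sym (inv-fun h v))
                (within-map h (within-trans (within-sym toᵛ) toᵍᵛ))
      invariant : InvariantNear N k (fun h v)
      invariant y p = begin
        α (fun h (fun g z₀))    ≡⟨ sym (agree (fun g z₀) (within-mono (+-monoʳ-≤ N (m≤m+n b a))
                                     (within-trans toᵍᵛ (within-map g near)))) ⟩
        x (fun g z₀)            ≡⟨ sym (gx≈x (fun g z₀)) ⟩
        x (inv g (fun g z₀))    ≡⟨ cong x (inv-fun g z₀) ⟩
        x z₀                    ≡⟨ agree z₀ (within-mono (+-monoʳ-≤ N (m≤n+m a b)) (within-trans toᵛ near)) ⟩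
        α (fun h z₀)            ≡⟨ cong α (fun-inv h y) ⟩
        α y                    ∎
        where
        open ≡-Reasoning
        z₀ = inv h y
        near : Within N v z₀
        near = subst (λ u → Within N u z₀) (inv-fun h v) (within-map (inverse h) p)

-- Components and closures in the quotient.

module _ {Δ : ℕ} where

  -- Both `_∼_` and `Edge` are contained in this relation, so a whole component lies in one orbit.
  record InOrbit (x y : Coloring Δ) : Set where
    constructor orbit
    field
      mover : Aut Δ
      moved : ∀ v → y v ≡ x (fun mover v)

  InOrbit-sym : ∀ {x y} → InOrbit x y → InOrbit y x
  InOrbit-sym {x} (orbit h eq) = orbit (inverse h)
    λ v → trans (cong x (sym (fun-inv h v))) (sym (eq (inv h v)))

  InOrbit-trans : ∀ {x y z} → InOrbit x y → InOrbit y z → InOrbit x z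
  InOrbit-trans (orbit h eq) (orbit h′ eq′) = orbit (h ∘ₐ h′) λ v → trans (eq′ v) (eq (fun h′ v))

  ∼-InOrbit : ∀ x y → _∼_ Δ x y → InOrbit x y
  ∼-InOrbit x y (g , _ , eq) = orbit (inverse g) λ v → sym (eq v)

  edge-InOrbit : ∀ x y → Edge Δ x y → InOrbit x y
  edge-InOrbit x y e with e x (identity , refl , λ _ → refl)
  ... | g , _ , gx∼y = InOrbit-trans (orbit (inverse g) λ _ → refl) (∼-InOrbit (act Δ g x) y gx∼y)

  component-InOrbit : ∀ {x y} → Component Δ x y → InOrbit x y
  component-InOrbit (base x∼y _) = ∼-InOrbit _ _ x∼y
  component-InOrbit (step c _ (inj₁ e)) = InOrbit-trans (component-InOrbit c) (edge-InOrbit _ _ e)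
  component-InOrbit (step c _ (inj₂ e)) = InOrbit-trans (component-InOrbit c) (InOrbit-sym (edge-InOrbit _ _ e))

  -- The saturation of the radius-n cylinder around y.
  AgreesUpToRotation : ℕ → Coloring Δ → Coloring Δ → Set
  AgreesUpToRotation n y z = Σ (Aut Δ) λ h → fun h (root Δ) ≡ root Δ ×
                             (∀ v → Within n (root Δ) v → y v ≡ z (fun h v))

  rotation-saturated : ∀ n y → Saturated Δ (AgreesUpToRotation n y)
  rotation-saturated n y x z (g , g-root , gx≈z) (h , h-root , eq) =
    g ∘ₐ h , trans (cong (fun g) h-root) g-root , λ v p →
      trans (eq v p) (trans (cong x (sym (inv-fun g (fun h v)))) (gx≈z (fun g (fun h v))))

  -- A root-fixing `h` maps the ball of radius `n` into itself, so the same `n` serves at every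
  -- point.
  rotation-open : ∀ n y → OpenProd Δ (AgreesUpToRotation n y)
  rotation-open n y x (h , h-root , eq) = n , λ z x≡z → h , h-root , λ v p →
    trans (eq v p) (x≡z (fun h v) (≤-trans
      (within-depth (subst (λ u → Within n u (fun h v)) h-root (within-map h p))) (≤-reflexive (+-identityʳ n))))

-- The saturated cylinder of radius `n` about `y` meets the component; composing its rotation with
-- the automorphism reaching that member yields the translate of `α`.
closure-orbit-limit : ∀ {l y} → InClosure (3 + l) (Component (3 + l) α) y → OrbitLimit y
closure-orbit-limit {y = y} y∈ n
  with y∈ (AgreesUpToRotation n y) (rotation-saturated n y) (rotation-open n y)
          (identity , refl , λ _ _ → refl)
... | z , (h , _ , eq) , c with component-InOrbit c
...   | orbit g eq′ = g ∘ₐ h , λ v p → trans (eq v p) (eq′ (fun h v))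

theorem3p5 : (Δ : ℕ) → 2 < Δ → Σ (Coloring Δ) λ α → Hyperaperiodic Δ α
theorem3p5 (suc (suc (suc l))) _ =
  α , orbit-limit-free (λ _ → identity , λ _ _ → refl) , λ _ y∈ → orbit-limit-free (closure-orbit-limit y∈)
theorem3p5 (suc zero) (s≤s ())
theorem3p5 (suc (suc zero)) (s≤s (s≤s ()))
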